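{- Let $K$ be a field and let $F, N \ge 1$ be integers. Let $\mathbf{A}^{(1)}, \dots, \mathbf{A}^{(N)}$ be $F \times F$ matrices over $K$, and let $\mathbf{X}$ and $\mathbf{Y}$ be $N \times N$ matrices over $K$. For $1 \le n \le N$, let $\mathbf{x}^{(n)}$ be the $n$-th column of $\mathbf{X}$, let $\mathbf{y}^{(n)}$ be the $n$-th column of $\mathbf{Y}$, and set $\mathbf{B}^{(n)} = \mathbf{x}^{(n)} {\mathbf{y}^{(n)}}^{T}$, an $N \times N$ matrix. Let $$\mathbf{G} = \sum_{n=1}^{N} \mathbf{A}^{(n)} \otimes \mathbf{B}^{(n)},$$ which is an $FN \times FN$ matrix. Then $$\det(\mathbf{G}) = \left( \prod_{n=1}^{N} \det(\mathbf{A}^{(n)}) \right) \det(\mathbf{X})^{F} \det(\mathbf{Y})^{F}.$$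
   Context: Here $\otimes$ denotes the Kronecker product of matrices: for an $F \times F$ matrix $\mathbf{A}$ and an $N \times N$ matrix $\mathbf{B}$, $\mathbf{A} \otimes \mathbf{B}$ is the $FN \times FN$ block matrix whose $(i,j)$ block (for $1 \le i,j \le F$) is the $N \times N$ matrix $\mathbf{A}_{ij}\mathbf{B}$. The vectors $\mathbf{x}^{(n)}, \mathbf{y}^{(n)}$ are regarded as column vectors of length $N$, and $T$ denotes transpose (without conjugation). The number $N$ of summands equals the size of the matrices $\mathbf{X}$, $\mathbf{Y}$ and $\mathbf{B}^{(n)}$. -}

module Defs where

open import Algebra.Bundles using (CommutativeRing; Semiring)
import Algebra.Definitions.RawSemiring as RawSemiringDefinitions
open import Data.Fin.Base using (Fin; zero; suc; toℕ; punchIn; remQuot)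
import Data.Nat.Base as ℕ
open ℕ using (ℕ; zero; suc)
open import Data.Product.Base using (_,_)
open import Data.Vec.Functional using (Vector)

module Matrices {c ℓ} (R : CommutativeRing c ℓ) where
  open CommutativeRing R using (Carrier; _*_; -_; 1#)
  open RawSemiringDefinitions (Semiring.rawSemiring (CommutativeRing.semiring R)) public
    using (sum; product; _^_)

  infixl 7 _·_ _⊗_

  Matrix : ℕ → ℕ → Set c
  Matrix m n = Vector (Vector Carrier n) m

  column : ∀ {m n} → Matrix m n → Fin n → Matrix m 1
  column M j i _ = M i j

  _·_ : ∀ {m n p} → Matrix m n → Matrix n p → Matrix m p
  (M · M′) i k = sum (λ j → M i j * M′ j k)

  sumᴹ : ∀ {m n k} → Vector (Matrix m n) k → Matrix m n
  sumᴹ Ms i j = sum (λ k → Ms k i j)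

  -- A row index r of the product, counted from 0, is i * p + k, where i is the
  -- block and k the position within it; likewise s = j * q + l for columns.
  _⊗_ : ∀ {m n p q} → Matrix m n → Matrix p q → Matrix (m ℕ.* p) (n ℕ.* q)
  _⊗_ {m} {n} {p} {q} A B r s =
    let i , k = remQuot {m} p r
        j , l = remQuot {n} q s
    in A i j * B k l

  -- Laplace expansion along the first row; the 0 × 0 determinant is 1.
  det : ∀ {n} → Matrix n n → Carrier
  det {zero}  M = 1#
  det {suc n} M =
    sum (λ j → (- 1#) ^ toℕ j * M zero j * det (λ i k → M (suc i) (punchIn j k)))

{-# OPTIONS --safe #-}
-- G = (I ⊗ X) · D · (I ⊗ Yᵀ), where D = Σ A⁽ⁿ⁾ ⊗ Eₙₙ becomes block diagonal with
-- blocks A⁽¹⁾, …, A⁽ᴺ⁾ once the two factors of the index set are interchanged.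
-- Multiplicativity of det and its invariance under simultaneous permutation of rows
-- and columns both follow from the fact that an alternating multilinear form is
-- determined by its value at the identity matrix.
module Submission where

open import Defs
open import Algebra.Apartness.Bundles using (HeytingField; HeytingCommutativeRing)
open import Algebra.Bundles using (CommutativeRing)
import Algebra.Properties.Monoid.Sum as MonoidSum
import Algebra.Properties.Ring as RingProperties
import Algebra.Properties.Semiring.Sum as SemiringSum
import Algebra.Solver.Ring.NaturalCoefficients.Default as SemiringSolver
open import Data.Fin.Base using (Fin; zero; suc; toℕ; punchIn; punchOut; remQuot; combine; _↑ˡ_; _↑ʳ_)
open import Data.Fin.Permutation using (Permutation; _⟨$⟩ʳ_; _⟨$⟩ˡ_; inverseˡ; inverseʳ)
open import Data.Fin.Properties using (_≟_; any?; pigeonhole; punchOut-injective; <⇒≢; suc-injective;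
  toℕ-↑ˡ; splitAt-↑ʳ; remQuot-combine; *↔×)
open import Data.List.Base using (List; []; _∷_; allFin)
open import Data.List.Membership.Propositional using (_∈_)
open import Data.List.Membership.Propositional.Properties using (∈-allFin)
open import Data.List.Relation.Unary.Any using (here; there)
open import Data.Nat.Base using (ℕ; zero; suc; NonZero) renaming (_+_ to _ℕ+_; _*_ to _ℕ*_)
open import Data.Nat.Properties using (n<1+n)
open import Data.Product.Base using (_×_; _,_; ∃; proj₁; proj₂; map₁)
open import Data.Product.Algebra using (×-comm)
open import Data.Sum.Base using (_⊎_; inj₁; inj₂)
open import Data.Vec.Functional using (Vector; transpose; updateAt)
open import Data.Vec.Functional.Properties using (updateAt-updates; updateAt-minimal)
open import Function.Base using (_∘_; const)
open import Function.Construct.Composition using (_↔-∘_)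
open import Function.Construct.Symmetry using (↔-sym)
open import Level using (_⊔_)
open import Relation.Binary.PropositionalEquality.Core as ≡ using (_≡_; _≢_)
import Relation.Binary.Reasoning.Setoid as SetoidReasoning
open import Relation.Nullary using (yes; no; contradiction)

module Determinant {c ℓ} (R : CommutativeRing c ℓ) where
  open CommutativeRing R hiding (zero)
  open Matrices R
  open RingProperties ring using (-1*x≈-x)
  open SemiringSum semiring
    using (sum-cong-≋; ∑-distrib-+; ∑-comm; *-distribˡ-sum; *-distribʳ-sum; sum-replicate-zero)
  open SemiringSolver commutativeSemiring using (solve; _:=_; _:+_; _:*_)
  open SetoidReasoning setoid

  private
    variable
      k m n p q : ℕ

  -- Pointwise equality, the identity matrix and finite sums.

  infix 4 _≋_
  _≋_ : Matrix m n → Matrix m n → Set ℓ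
  M ≋ N = ∀ i j → M i j ≈ N i j

  ≡⇒≈ : {u v : Vector Carrier n} → u ≡ v → ∀ j → u j ≈ v j
  ≡⇒≈ u≡v j = reflexive (≡.cong (λ w → w j) u≡v)

  minor : Matrix (suc m) (suc n) → Fin (suc n) → Matrix m n
  minor M j i k = M (suc i) (punchIn j k)

  sign : Fin n → Carrier
  sign j = (- 1#) ^ toℕ j

  -- Recursion on both indices makes the minor of `δ` at position (0, 0) reduce to the smaller `δ`,
  -- which `det-δ` relies on.
  δ : Matrix n n
  δ zero    zero    = 1#
  δ zero    (suc j) = 0#
  δ (suc i) zero    = 0#
  δ (suc i) (suc j) = δ i j

  δ-diagonal : (i : Fin n) → δ i i ≡ 1#
  δ-diagonal zero    = ≡.refl
  δ-diagonal (suc i) = δ-diagonal i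

  δ-off-diagonal : {i j : Fin n} → i ≢ j → δ i j ≡ 0#
  δ-off-diagonal {i = zero}  {zero}  i≢j = contradiction ≡.refl i≢j
  δ-off-diagonal {i = zero}  {suc j} i≢j = ≡.refl
  δ-off-diagonal {i = suc i} {zero}  i≢j = ≡.refl
  δ-off-diagonal {i = suc i} {suc j} i≢j = δ-off-diagonal (i≢j ∘ ≡.cong suc)

  δ-injective : (π : Fin m → Fin n) → (∀ {i j} → π i ≡ π j → i ≡ j) →
                ∀ i j → δ (π i) (π j) ≡ δ i j
  δ-injective π inj i j with i ≟ j
  ... | yes ≡.refl = ≡.trans (δ-diagonal (π i)) (≡.sym (δ-diagonal i))
  ... | no i≢j     = ≡.trans (δ-off-diagonal (i≢j ∘ inj)) (≡.sym (δ-off-diagonal i≢j))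

  sum-zero : {t : Vector Carrier n} → (∀ i → t i ≈ 0#) → sum t ≈ 0#
  sum-zero {n} t≈0 = trans (sum-cong-≋ t≈0) (sum-replicate-zero n)

  sum-linear : ∀ a (s t : Vector Carrier n) →
               sum (λ i → a * s i + t i) ≈ a * sum s + sum t
  sum-linear a s t = trans (∑-distrib-+ (λ i → a * s i) t) (+-congʳ (sym (*-distribˡ-sum a s)))

  sum-δˡ : (i : Fin n) (t : Vector Carrier n) → sum (λ j → δ i j * t j) ≈ t i
  sum-δˡ zero t = trans (+-cong (*-identityˡ _) (sum-zero (λ j → zeroˡ (t (suc j))))) (+-identityʳ _)
  sum-δˡ (suc i) t = trans (+-cong (zeroˡ _) (sum-δˡ i (t ∘ suc))) (+-identityˡ _)

  sum-δʳ : (i : Fin n) (t : Vector Carrier n) → sum (λ j → t j * δ j i) ≈ t i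
  sum-δʳ zero t = trans (+-cong (*-identityʳ _) (sum-zero (λ j → zeroʳ (t (suc j))))) (+-identityʳ _)
  sum-δʳ (suc i) t = trans (+-cong (zeroʳ _) (sum-δʳ i (t ∘ suc))) (+-identityˡ _)

  sum-splitAt : ∀ m (t : Vector Carrier (m ℕ+ n)) →
                sum t ≈ sum (λ i → t (i ↑ˡ n)) + sum (λ j → t (m ↑ʳ j))
  sum-splitAt zero    t = sym (+-identityˡ _)
  sum-splitAt (suc m) t = trans (+-congˡ (sum-splitAt m (t ∘ suc))) (sym (+-assoc _ _ _))

  sum-combine : ∀ m (t : Vector Carrier (m ℕ* n)) →
                sum t ≈ sum {m} (λ i → sum {n} (λ k → t (combine i k)))
  sum-combine zero            t = refl
  sum-combine {n = n} (suc m) t =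
    trans (sum-splitAt n t) (+-congˡ (sum-combine m (t ∘ (n ↑ʳ_))))

  -- Laplace expansion: transposes and equal leading columns.

  det-cong : {M N : Matrix n n} → M ≋ N → det M ≈ det N
  det-cong {zero}  M≋N = refl
  det-cong {suc n} M≋N = sum-cong-≋ λ j →
    *-cong (*-congˡ {sign j} (M≋N zero j)) (det-cong (λ i k → M≋N (suc i) (punchIn j k)))

  -- Expanding first along the first row and then along the first column is symmetric
  -- in rows and columns.
  det-transpose : (M : Matrix n n) → det (transpose M) ≈ det M
  det-transpose {zero}        M = refl
  det-transpose {suc zero}    M = refl
  det-transpose {suc (suc n)} M = begin
    det (transpose M)
      ≈⟨ expand det-transpose (transpose M) ⟩
    1# * M zero zero * det (transpose M₀₀) +
      sum (λ i → sum (λ j → sign (suc i) * M (suc i) zero * (sign j * M zero (suc j) * det (M₂ i j))))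
      ≈⟨ +-cong (*-congˡ (det-transpose M₀₀)) (∑-comm {suc n} {suc n} (λ i j →
           sign (suc i) * M (suc i) zero * (sign j * M zero (suc j) * det (M₂ i j)))) ⟩
    1# * M zero zero * det M₀₀ +
      sum (λ j → sum (λ i → sign (suc i) * M (suc i) zero * (sign j * M zero (suc j) * det (M₂ i j))))
      ≈⟨ +-congˡ (sum-cong-≋ (λ j → sum-cong-≋ (λ i → trans
           -- `sign (suc i)` is `- 1#` times `sign i`. Moving that factor from `i` to `j` turns the
           -- signs of one expansion into those of the other.
           (solve 6 (λ s a b t x d → ((s :* a) :* b) :* ((t :* x) :* d) := ((s :* t) :* x) :* ((a :* b) :* d))
             refl (- 1#) (sign i) (M (suc i) zero) (sign j) (M zero (suc j)) (det (M₂ i j)))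
           (*-congˡ (*-congˡ (sym (det-transpose (M₂ i j)))))))) ⟩
    1# * M zero zero * det M₀₀ +
      sum (λ j → sum (λ i → sign (suc j) * M zero (suc j) * (sign i * M (suc i) zero * det (transpose (M₂ i j)))))
      ≈⟨ expand det-transpose M ⟨
    det M ∎
    where
    M₀₀ : Matrix (suc n) (suc n)
    M₀₀ i j = M (suc i) (suc j)

    M₂ : Fin (suc n) → Fin (suc n) → Matrix n n
    M₂ i j k l = M (suc (punchIn i k)) (suc (punchIn j l))

    -- The first column of `minor M (suc j)` is the tail of column 0 of `M`. Transposing the minor,
    -- by the induction hypothesis passed as first argument, expands it along that column.
    expand : (∀ N → det {suc n} (transpose N) ≈ det N) →
      (M : Matrix (suc (suc n)) (suc (suc n))) →
      det M ≈ 1# * M zero zero * det (λ i j → M (suc i) (suc j)) +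
        sum (λ j → sum (λ i → sign (suc j) * M zero (suc j) * (sign i * M (suc i) zero *
          det (λ l k → M (suc (punchIn i k)) (suc (punchIn j l))))))
    expand transposed M = +-congˡ (sum-cong-≋ λ j →
      trans (*-congˡ (sym (transposed (minor M (suc j)))))
            (*-distribˡ-sum (sign (suc j) * M zero (suc j))
              (λ i → sign i * M (suc i) zero * det (minor (transpose (minor M (suc j))) i))))

  -- Deleting column 0 or column 1 leaves the same minor, and these two terms have opposite signs.
  -- Deleting a later column keeps the two equal columns in front, so those terms vanish by
  -- induction.
  det-columns₀₁ : (M : Matrix (suc (suc n)) (suc (suc n))) →
                  (∀ i → M i zero ≈ M i (suc zero)) → det M ≈ 0#
  det-columns₀₁ {n} M M₀≈M₁ = begin
    1# * M zero zero * D + (- 1# * 1# * M zero (suc zero) * det (minor M (suc zero)) + rest M)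
      ≈⟨ +-congˡ (+-cong (*-cong (*-congˡ (sym (M₀≈M₁ zero))) (det-cong minors)) (rest≈0 M M₀≈M₁)) ⟩
    1# * M zero zero * D + (- 1# * 1# * M zero zero * D + 0#)
      ≈⟨ +-congˡ (trans (+-identityʳ _) (trans (*-assoc _ _ _) (*-assoc _ _ _))) ⟩
    1# * M zero zero * D + (- 1#) * (1# * (M zero zero * D))
      ≈⟨ +-cong (*-assoc _ _ _) (-1*x≈-x _) ⟩
    1# * (M zero zero * D) + - (1# * (M zero zero * D))
      ≈⟨ -‿inverseʳ _ ⟩
    0# ∎
    where
    D = det (minor M zero)

    minors : minor M (suc zero) ≋ minor M zero
    minors i zero    = M₀≈M₁ (suc i)
    minors i (suc k) = refl

    rest : ∀ {n} → Matrix (suc (suc n)) (suc (suc n)) → Carrier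
    rest {n} M = sum {n} (λ j → sign (suc (suc j)) * M zero (suc (suc j)) * det (minor M (suc (suc j))))

    rest≈0 : ∀ {n} (M : Matrix (suc (suc n)) (suc (suc n))) →
             (∀ i → M i zero ≈ M i (suc zero)) → rest M ≈ 0#
    rest≈0 {zero}  M M₀≈M₁ = refl
    rest≈0 {suc n} M M₀≈M₁ = sum-zero λ j →
      trans (*-congˡ (det-columns₀₁ (minor M (suc (suc j))) (M₀≈M₁ ∘ suc)))
            (zeroʳ (sign (suc (suc j)) * M zero (suc (suc j))))

  -- Multilinear and alternating functions of the rows.

  AgreeOff : Fin m → Matrix m n → Matrix m n → Set ℓ
  AgreeOff r M N = ∀ i → i ≢ r → ∀ j → M i j ≈ N i j

  -- Additivity and homogeneity are merged into one law. It relates three matrices through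
  -- `AgreeOff` and not by updating one of them, because pointwise equal matrices need not be equal
  -- as functions; `cong` is a field for the same reason.
  record IsMultilinear (f : Matrix m n → Carrier) : Set (c ⊔ ℓ) where
    field
      cong   : ∀ {M N} → M ≋ N → f M ≈ f N
      linear : ∀ r a {M P Q} → AgreeOff r M P → AgreeOff r M Q →
               (∀ j → M r j ≈ a * P r j + Q r j) → f M ≈ a * f P + f Q

    -- A zero row is minus itself plus itself, so `linear` applies with `P` and `Q` both equal to
    -- `M`.
    zero-row : ∀ r {M} → (∀ j → M r j ≈ 0#) → f M ≈ 0#
    zero-row r {M} Mᵣ≈0 = begin
      f M                ≈⟨ linear r (- 1#) (λ _ _ _ → refl) (λ _ _ _ → refl) row ⟩
      (- 1#) * f M + f M ≈⟨ +-congʳ (-1*x≈-x _) ⟩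
      - f M + f M        ≈⟨ -‿inverseˡ _ ⟩
      0#                 ∎
      where
      row : ∀ j → M r j ≈ (- 1#) * M r j + M r j
      row j = trans (Mᵣ≈0 j) (sym (trans (+-congʳ (-1*x≈-x _)) (-‿inverseˡ _)))

    additive : ∀ r {M P Q} → AgreeOff r M P → AgreeOff r M Q →
               (∀ j → M r j ≈ P r j + Q r j) → f M ≈ f P + f Q
    additive r M~P M~Q Mᵣ = trans
      (linear r 1# M~P M~Q (λ j → trans (Mᵣ j) (+-congʳ (sym (*-identityˡ _)))))
      (+-congʳ (*-identityˡ _))

    -- Induction on the number of summands: `linear` splits off the first one, with `Q` the matrix
    -- whose row `r` is the remaining sum. The empty sum is a zero row.
    row-combination : ∀ r {M} (a : Vector Carrier k) (P : Vector (Matrix m n) k) →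
                      (∀ l → AgreeOff r M (P l)) →
                      (∀ j → M r j ≈ sum (λ l → a l * P l r j)) →
                      f M ≈ sum (λ l → a l * f (P l))
    row-combination {k = zero}  r a P M~P Mᵣ = zero-row r Mᵣ
    row-combination {k = suc k} r {M} a P M~P Mᵣ = trans
      (linear r (a zero) (M~P zero)
        (λ i i≢r j → sym (≡⇒≈ (off i≢r) j))
        (λ j → trans (Mᵣ j) (+-congˡ (sym (≡⇒≈ at j)))))
      (+-congˡ (row-combination r (a ∘ suc) (P ∘ suc)
        (λ l i i≢r j → trans (≡⇒≈ (off i≢r) j) (M~P (suc l) i i≢r j))
        (≡⇒≈ at)))
      where
      tailRow : Vector Carrier n
      tailRow j = sum (λ l → a (suc l) * P (suc l) r j)

      off : ∀ {i} → i ≢ r → updateAt M r (const tailRow) i ≡ M i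
      off {i} i≢r = updateAt-minimal i r M i≢r

      at : updateAt M r (const tailRow) r ≡ tailRow
      at = updateAt-updates r M

    -- 0 = f(…a+b…a+b…) = f(…a…a…) + f(…a…b…) + f(…b…a…) + f(…b…b…)
    swap-rows : ∀ {r s} → r ≢ s → (∀ M → (∀ j → M r j ≈ M s j) → f M ≈ 0#) →
                ∀ {M N} → (∀ j → M r j ≈ N s j) → (∀ j → M s j ≈ N r j) →
                (∀ i → i ≢ r → i ≢ s → ∀ j → M i j ≈ N i j) → f M + f N ≈ 0#
    swap-rows {r} {s} r≢s alt {M} {N} Mᵣ Mₛ M~N = begin
      f M + f N
        ≈⟨ +-cong (cong M≋) (cong N≋) ⟩
      f (with-rows a b) + f (with-rows b a)
        ≈⟨ +-cong (+-identityˡ _) (+-identityʳ _) ⟨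
      (0# + f (with-rows a b)) + (f (with-rows b a) + 0#)
        ≈⟨ +-cong (+-congʳ (diagonal a)) (+-congˡ (diagonal b)) ⟨
      (f (with-rows a a) + f (with-rows a b)) + (f (with-rows b a) + f (with-rows b b))
        ≈⟨ +-cong (additiveₛ a) (additiveₛ b) ⟨
      f (with-rows a (a ⊞ b)) + f (with-rows b (a ⊞ b))
        ≈⟨ additive r
             (λ i i≢r j → trans (agree i i≢r) (sym (agree i i≢r)))
             (λ i i≢r j → trans (agree i i≢r) (sym (agree i i≢r)))
             (λ j → trans (atᵣ j) (sym (+-cong (atᵣ j) (atᵣ j)))) ⟨
      f (with-rows (a ⊞ b) (a ⊞ b))
        ≈⟨ diagonal (a ⊞ b) ⟩
      0# ∎
      where
      a = M r
      b = M s

      _⊞_ : Vector Carrier n → Vector Carrier n → Vector Carrier n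
      (u ⊞ v) j = u j + v j

      base : Vector Carrier n → Matrix m n
      base v = updateAt M s (const v)

      with-rows : Vector Carrier n → Vector Carrier n → Matrix m n
      with-rows u v = updateAt (base v) r (const u)

      agree : ∀ {u v j} i → i ≢ r → with-rows u v i j ≈ base v i j
      agree {u} {v} {j} i i≢r = ≡⇒≈ (updateAt-minimal i r (base v) i≢r) j

      atᵣ : ∀ {u v} j → with-rows u v r j ≈ u j
      atᵣ {u} {v} = ≡⇒≈ (updateAt-updates r (base v))

      atₛ : ∀ {u v} j → with-rows u v s j ≈ v j
      atₛ {u} {v} j = trans (agree s (r≢s ∘ ≡.sym))
        (≡⇒≈ (updateAt-updates s M) j)

      off : ∀ {u v i} → i ≢ r → i ≢ s → ∀ j → with-rows u v i j ≈ M i j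
      off {i = i} i≢r i≢s j = trans (agree i i≢r)
        (≡⇒≈ (updateAt-minimal i s M i≢s) j)

      diagonal : ∀ u → f (with-rows u u) ≈ 0#
      diagonal u = alt (with-rows u u) (λ j → trans (atᵣ j) (sym (atₛ j)))

      agreeₛ : ∀ {u v w} → AgreeOff s (with-rows u v) (with-rows u w)
      agreeₛ i i≢s j with i ≟ r
      ... | yes ≡.refl = trans (atᵣ j) (sym (atᵣ j))
      ... | no i≢r     = trans (off i≢r i≢s j) (sym (off i≢r i≢s j))

      additiveₛ : ∀ u → f (with-rows u (a ⊞ b)) ≈ f (with-rows u a) + f (with-rows u b)
      additiveₛ u = additive s agreeₛ agreeₛ (λ j → trans (atₛ j) (sym (+-cong (atₛ j) (atₛ j))))

      M≋ : M ≋ with-rows a b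
      M≋ i j with i ≟ r | i ≟ s
      ... | yes ≡.refl | _          = sym (atᵣ j)
      ... | no _       | yes ≡.refl = sym (atₛ j)
      ... | no i≢r     | no i≢s     = sym (off i≢r i≢s j)

      N≋ : N ≋ with-rows b a
      N≋ i j with i ≟ r | i ≟ s
      ... | yes ≡.refl | _          = trans (sym (Mₛ j)) (sym (atᵣ j))
      ... | no _       | yes ≡.refl = trans (sym (Mᵣ j)) (sym (atₛ j))
      ... | no i≢r     | no i≢s     = trans (sym (M~N i i≢r i≢s j)) (sym (off i≢r i≢s j))

  -- Alternation means vanishing on two equal rows; a change of sign under interchange would be
  -- weaker in characteristic 2.
  record IsAlternating (f : Matrix m n → Carrier) : Set (c ⊔ ℓ) where
    field
      isMultilinear : IsMultilinear f
      alternating   : ∀ {r s} → r ≢ s → ∀ M → (∀ j → M r j ≈ M s j) → f M ≈ 0#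

    open IsMultilinear isMultilinear public

  -- The determinant as a normalised alternating form.

  -- In row 0 the entries vary while the minors agree; in a later row the entries of row 0 agree and
  -- each minor is linear by induction.
  det-linear : ∀ r a {M P Q : Matrix n n} → AgreeOff r M P → AgreeOff r M Q →
               (∀ j → M r j ≈ a * P r j + Q r j) → det M ≈ a * det P + det Q
  det-linear {suc n} zero a {M} {P} {Q} M~P M~Q M₀ = trans
    (sum-cong-≋ λ j → begin
      sign j * M zero j * det (minor M j)
        ≈⟨ *-congʳ (*-congˡ (M₀ j)) ⟩
      sign j * (a * P zero j + Q zero j) * det (minor M j)
        ≈⟨ solve 5 (λ s a x y d → (s :* ((a :* x) :+ y)) :* d := ((a :* ((s :* x) :* d)) :+ ((s :* y) :* d)))
             refl (sign j) a (P zero j) (Q zero j) (det (minor M j)) ⟩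
      a * (sign j * P zero j * det (minor M j)) + sign j * Q zero j * det (minor M j)
        ≈⟨ +-cong (*-congˡ (*-congˡ (det-cong (λ i k → M~P (suc i) (λ ()) (punchIn j k)))))
                  (*-congˡ (det-cong (λ i k → M~Q (suc i) (λ ()) (punchIn j k)))) ⟩
      a * (sign j * P zero j * det (minor P j)) + sign j * Q zero j * det (minor Q j) ∎)
    (sum-linear a (λ j → sign j * P zero j * det (minor P j)) (λ j → sign j * Q zero j * det (minor Q j)))
  det-linear {suc n} (suc r) a {M} {P} {Q} M~P M~Q Mᵣ = trans
    (sum-cong-≋ λ j → begin
      sign j * M zero j * det (minor M j)
        ≈⟨ *-congˡ (det-linear r a {minor M j} {minor P j} {minor Q j}
             (λ i i≢r k → M~P (suc i) (i≢r ∘ suc-injective) (punchIn j k))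
             (λ i i≢r k → M~Q (suc i) (i≢r ∘ suc-injective) (punchIn j k))
             (λ k → Mᵣ (punchIn j k))) ⟩
      sign j * M zero j * (a * det (minor P j) + det (minor Q j))
        ≈⟨ solve 5 (λ s a x d e → (s :* x) :* ((a :* d) :+ e) := ((a :* ((s :* x) :* d)) :+ ((s :* x) :* e)))
             refl (sign j) a (M zero j) (det (minor P j)) (det (minor Q j)) ⟩
      a * (sign j * M zero j * det (minor P j)) + sign j * M zero j * det (minor Q j)
        ≈⟨ +-cong (*-congˡ (*-congʳ (*-congˡ (M~P zero (λ ()) j)))) (*-congʳ (*-congˡ (M~Q zero (λ ()) j))) ⟩
      a * (sign j * P zero j * det (minor P j)) + sign j * Q zero j * det (minor Q j) ∎)
    (sum-linear a (λ j → sign j * P zero j * det (minor P j)) (λ j → sign j * Q zero j * det (minor Q j)))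

  det-isMultilinear : IsMultilinear (det {n})
  det-isMultilinear = record { cong = det-cong ; linear = det-linear }

  -- Two equal rows below row 0 survive in every minor, so induction applies. Equality of rows 0 and
  -- 1 is `det-columns₀₁` for the transpose, and any other row equal to row 0 is first brought next
  -- to it.
  det-alternating : {r s : Fin n} → r ≢ s → (M : Matrix n n) → (∀ j → M r j ≈ M s j) → det M ≈ 0#
  det-alternating {suc n} = cases
    where
    below : ∀ {r s : Fin n} → r ≢ s → (M : Matrix (suc n) (suc n)) →
            (∀ j → M (suc r) j ≈ M (suc s) j) → det M ≈ 0#
    below r≢s M Mᵣ≈Mₛ = sum-zero λ j →
      trans (*-congˡ (det-alternating r≢s (minor M j) (λ k → Mᵣ≈Mₛ (punchIn j k)))) (zeroʳ (sign j * M zero j))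

    first : ∀ {n} → (∀ {r s : Fin n} → r ≢ s → (M : Matrix (suc n) (suc n)) →
              (∀ j → M (suc r) j ≈ M (suc s) j) → det M ≈ 0#) →
            ∀ s (M : Matrix (suc n) (suc n)) → (∀ j → M zero j ≈ M (suc s) j) → det M ≈ 0#
    first below zero    M M₀≈M₁ =
      trans (sym (det-transpose M)) (det-columns₀₁ (transpose M) M₀≈M₁)
    -- Interchanging the rows 1 and 2 + s makes the two equal rows adjacent.
    first below (suc s) M M₀≈Mₛ = begin
      det M         ≈⟨ +-identityʳ _ ⟨
      det M + 0#    ≈⟨ +-congˡ (first below zero N M₀≈Mₛ) ⟨
      det M + det N ≈⟨ IsMultilinear.swap-rows det-isMultilinear {suc zero} {suc (suc s)} (λ ())
                         (below {zero} {suc s} (λ ()))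
                         (λ j → sym (≡⇒≈ (updateAt-updates s M″) j))
                         (λ j → refl) agree ⟩
      0#            ∎
      where
      M″ : Matrix _ _
      M″ i = M (suc (suc i))

      N : Matrix _ _
      N zero          = M zero
      N (suc zero)    = M (suc (suc s))
      N (suc (suc i)) = updateAt M″ s (const (M (suc zero))) i

      agree : ∀ i → i ≢ suc zero → i ≢ suc (suc s) → ∀ j → M i j ≈ N i j
      agree zero          _   _   j = refl
      agree (suc zero)    i≢1 _   j = contradiction ≡.refl i≢1
      agree (suc (suc i)) _   i≢s j =
        sym (≡⇒≈ (updateAt-minimal i s M″ (i≢s ∘ ≡.cong (λ i → suc (suc i)))) j)

    cases : {r s : Fin (suc n)} → r ≢ s → (M : Matrix (suc n) (suc n)) →
            (∀ j → M r j ≈ M s j) → det M ≈ 0#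
    cases {zero}  {zero}  r≢s M Mᵣ≈Mₛ = contradiction ≡.refl r≢s
    cases {zero}  {suc s} r≢s M Mᵣ≈Mₛ = first below s M Mᵣ≈Mₛ
    cases {suc r} {zero}  r≢s M Mᵣ≈Mₛ = first below r M (sym ∘ Mᵣ≈Mₛ)
    cases {suc r} {suc s} r≢s M Mᵣ≈Mₛ = below (r≢s ∘ ≡.cong suc) M Mᵣ≈Mₛ

  det-isAlternating : IsAlternating (det {n})
  det-isAlternating = record { isMultilinear = det-isMultilinear ; alternating = det-alternating }

  det-δ : det {n} δ ≈ 1#
  det-δ {zero}  = refl
  det-δ {suc n} = begin
    1# * 1# * det {n} δ + sum {n} (λ j → sign (suc j) * 0# * det (minor {n} {n} δ (suc j)))
      ≈⟨ +-cong (trans (*-cong (*-identityˡ 1#) (det-δ {n})) (*-identityˡ 1#))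
                (sum-zero {n} (λ j → trans (*-congʳ (zeroʳ _)) (zeroˡ _))) ⟩
    1# + 0# ≈⟨ +-identityʳ 1# ⟩
    1#      ∎

  -- Uniqueness of alternating forms.

  -- These matrices, with standard basis vectors as rows, are what `alternating≈0` reduces to.
  -- Because `f δ` vanishes, interchanges of rows can be followed without recording a sign.
  alternating-δ∘φ≈0 : {f : Matrix n n → Carrier} → IsAlternating f → f δ ≈ 0# →
                      (φ : Fin n → Fin n) → f (δ ∘ φ) ≈ 0#
  -- Without rows, every matrix is pointwise `δ`.
  alternating-δ∘φ≈0 {zero} {f} alt fδ≈0 φ = trans (IsAlternating.cong alt (λ ())) fδ≈0
  alternating-δ∘φ≈0 {suc n} {f} alt fδ≈0 φ = sort (allFin (suc n)) φ (inj₁ ∘ ∈-allFin)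
    where
    open IsAlternating alt

    -- Each step interchanges two rows so as to bring δ r into row r; this is impossible
    -- only if φ misses r, and then φ takes some value twice.
    sort : (unsorted : List (Fin (suc n))) (φ : Fin (suc n) → Fin (suc n)) →
           (∀ i → i ∈ unsorted ⊎ φ i ≡ i) → f (δ ∘ φ) ≈ 0#
    sort [] φ φ≗id = trans (cong λ i j → ≡⇒≈ (≡.cong δ (φ-fixes i)) j) fδ≈0
      where
      φ-fixes : ∀ i → φ i ≡ i
      φ-fixes i with φ≗id i
      ... | inj₂ φi≡i = φi≡i
    sort (r ∷ rs) φ φ≗id with any? (λ s → φ s ≟ r)
    ... | no r∉φ =
      -- Punching out `r` places the values of `φ` in `Fin n`, so two of the `suc n` indices
      -- collide.
      let i , j , i<j , eq = pigeonhole (n<1+n n) (λ i → punchOut (r≢φ i))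
      in alternating (<⇒≢ i<j) (δ ∘ φ) (≡⇒≈ (≡.cong δ (punchOut-injective (r≢φ i) (r≢φ j) eq)))
      where
      r≢φ : ∀ i → r ≢ φ i
      r≢φ i r≡φi = r∉φ (i , ≡.sym r≡φi)
    ... | yes (s , φs≡r) with r ≟ s
    ...   | yes ≡.refl = sort rs φ unsorted
      where
      unsorted : ∀ i → i ∈ rs ⊎ φ i ≡ i
      unsorted i with φ≗id i
      ... | inj₁ (here ≡.refl) = inj₂ φs≡r
      ... | inj₁ (there i∈rs)  = inj₁ i∈rs
      ... | inj₂ φi≡i          = inj₂ φi≡i
    ...   | no r≢s = begin
      f (δ ∘ φ)               ≈⟨ +-identityʳ _ ⟨
      f (δ ∘ φ) + 0#          ≈⟨ +-congˡ (sort rs ψ unsorted) ⟨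
      f (δ ∘ φ) + f (δ ∘ ψ)   ≈⟨ swap-rows r≢s (alternating r≢s)
                                   (≡⇒≈ (≡.cong δ (≡.sym ψs)))
                                   (≡⇒≈ (≡.cong δ (≡.trans φs≡r (≡.sym ψr))))
                                   (λ i i≢r i≢s → ≡⇒≈ (≡.cong δ (≡.sym (ψ-off i≢r i≢s)))) ⟩
      0#                      ∎
      where
      ψ₀ ψ : Fin (suc n) → Fin (suc n)
      ψ₀ = updateAt φ s (const (φ r))
      ψ  = updateAt ψ₀ r (const r)

      ψr : ψ r ≡ r
      ψr = updateAt-updates r ψ₀

      ψs : ψ s ≡ φ r
      ψs = ≡.trans (updateAt-minimal s r ψ₀ (r≢s ∘ ≡.sym)) (updateAt-updates s φ)

      ψ-off : ∀ {i} → i ≢ r → i ≢ s → ψ i ≡ φ i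
      ψ-off {i} i≢r i≢s = ≡.trans (updateAt-minimal i r ψ₀ i≢r) (updateAt-minimal i s φ i≢s)

      unsorted : ∀ i → i ∈ rs ⊎ ψ i ≡ i
      unsorted i with i ≟ r | φ≗id i
      ... | yes ≡.refl | _                  = inj₂ ψr
      ... | no i≢r     | inj₁ (here i≡r)    = contradiction i≡r i≢r
      ... | no i≢r     | inj₁ (there i∈rs)  = inj₁ i∈rs
      ... | no i≢r     | inj₂ φi≡i          = inj₂ (≡.trans (ψ-off i≢r i≢s) φi≡i)
        where
        -- The interchange spoils no row already in place: `φ s` is `r`, which differs from `s`, so
        -- `s` was not fixed.
        i≢s : i ≢ s
        i≢s i≡s = i≢r (≡.trans (≡.sym φi≡i) (≡.trans (≡.cong φ i≡s) φs≡r))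

  -- Each row is expanded in the standard basis, with its own entries as coefficients, until all
  -- rows are basis vectors. The list `rows` contains every row not yet known to be one.
  alternating≈0 : {f : Matrix n n → Carrier} → IsAlternating f → f δ ≈ 0# → ∀ M → f M ≈ 0#
  alternating≈0 {n} {f} alt fδ≈0 M = expand (allFin n) M (inj₁ ∘ ∈-allFin)
    where
    open IsAlternating alt

    expand : (rows : List (Fin n)) (M : Matrix n n) →
             (∀ i → i ∈ rows ⊎ ∃ λ k → ∀ j → M i j ≈ δ k j) → f M ≈ 0#
    expand [] M M≋δ = trans (cong (proj₂ ∘ standard)) (alternating-δ∘φ≈0 alt fδ≈0 (proj₁ ∘ standard))
      where
      standard : ∀ i → ∃ λ k → ∀ j → M i j ≈ δ k j
      standard i with M≋δ i
      ... | inj₂ Mᵢ = Mᵢ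
    expand (r ∷ rs) M M≋δ = trans
      (row-combination r (M r) (λ k → updateAt M r (const (δ k)))
        (λ k i i≢r → ≡⇒≈ (≡.sym (updateAt-minimal i r M i≢r)))
        (λ j → sym (trans
          (sum-cong-≋ (λ k → *-congˡ {M r k} (≡⇒≈ (updateAt-updates r M) j)))
          (sum-δʳ j (M r)))))
      (sum-zero {n} λ k → trans (*-congˡ (expand rs (updateAt M r (const (δ k))) (standard k))) (zeroʳ (M r k)))
      where
      standard : ∀ k i → i ∈ rs ⊎ ∃ λ l → ∀ j → updateAt M r (const (δ k)) i j ≈ δ l j
      standard k i with i ≟ r | M≋δ i
      ... | yes ≡.refl | _                 = inj₂ (k , ≡⇒≈ (updateAt-updates i M))
      ... | no i≢r     | inj₁ (here i≡r)   = contradiction i≡r i≢r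
      ... | no i≢r     | inj₁ (there i∈rs) = inj₁ i∈rs
      ... | no i≢r     | inj₂ (l , Mᵢ)     =
        inj₂ (l , λ j → trans (≡⇒≈ (updateAt-minimal i r M i≢r) j) (Mᵢ j))

  -- Needed to subtract a multiple of `det` from an alternating form in `alternating-unique`.
  alternating-+* : {f g : Matrix m n → Carrier} → IsAlternating f → IsAlternating g →
                   ∀ b → IsAlternating (λ M → f M + b * g M)
  alternating-+* {f = f} {g} F G b = record
    { isMultilinear = record
      { cong   = λ M≋N → +-cong (F.cong M≋N) (*-congˡ (G.cong M≋N))
      ; linear = λ r a {M} {P} {Q} M~P M~Q Mᵣ → trans
          (+-cong (F.linear r a M~P M~Q Mᵣ) (*-congˡ (G.linear r a M~P M~Q Mᵣ)))
          (solve 6 (λ a b x y z w →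
              ((a :* x) :+ y) :+ (b :* ((a :* z) :+ w)) := (a :* (x :+ (b :* z))) :+ (y :+ (b :* w)))
            refl a b (f P) (f Q) (g P) (g Q))
      }
    ; alternating = λ r≢s M Mᵣ≈Mₛ → trans
        (+-cong (F.alternating r≢s M Mᵣ≈Mₛ) (trans (*-congˡ (G.alternating r≢s M Mᵣ≈Mₛ)) (zeroʳ b)))
        (+-identityʳ 0#)
    }
    where
    module F = IsAlternating F
    module G = IsAlternating G

  -- The difference of the two sides is alternating in `M` and vanishes at `δ`, since `det δ` is 1;
  -- hence it vanishes everywhere.
  alternating-unique : {f : Matrix n n → Carrier} → IsAlternating f → ∀ M → f M ≈ f δ * det M
  alternating-unique {n} {f} alt M = begin
    f M                                      ≈⟨ +-identityʳ _ ⟨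
    f M + 0#                                 ≈⟨ +-congˡ (trans (*-congʳ (-‿inverseˡ (f δ))) (zeroˡ _)) ⟨
    f M + (- f δ + f δ) * det M              ≈⟨ solve 4 (λ x y z d → x :+ ((y :+ z) :* d) := (x :+ (y :* d)) :+ (z :* d))
                                                 refl (f M) (- f δ) (f δ) (det M) ⟩
    (f M + (- f δ) * det M) + f δ * det M    ≈⟨ +-congʳ (alternating≈0 (alternating-+* alt det-isAlternating (- f δ)) at-δ M) ⟩
    0# + f δ * det M                         ≈⟨ +-identityˡ _ ⟩
    f δ * det M                              ∎
    where
    at-δ : f δ + (- f δ) * det {n} δ ≈ 0#
    at-δ = trans (+-congˡ (trans (*-congˡ (det-δ {n})) (*-identityʳ _))) (-‿inverseʳ _)

  -- Multiplicativity and invariance under relabelling.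

  -- Row `r` of `M · N` depends linearly on row `r` of `M` alone. For fixed `N` the left side is
  -- therefore alternating in `M`, with value `det N` at `δ`.
  det-· : (M N : Matrix n n) → det (M · N) ≈ det M * det N
  det-· {n} M N = begin
    det (M · N)         ≈⟨ alternating-unique alt M ⟩
    det (δ · N) * det M ≈⟨ *-congʳ (det-cong (λ i j → sum-δˡ i (λ k → N k j))) ⟩
    det N * det M       ≈⟨ *-comm _ _ ⟩
    det M * det N       ∎
    where
    alt : IsAlternating (λ M → det {n} (M · N))
    alt = record
      { isMultilinear = record
        { cong   = λ M≋M′ → det-cong (λ i j → ·-congʳ (M≋M′ i) j)
        ; linear = λ r a {M} {P} {Q} M~P M~Q Mᵣ → det-linear r a {M · N} {P · N} {Q · N}
            (λ i i≢r j → ·-congʳ (M~P i i≢r) j)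
            (λ i i≢r j → ·-congʳ (M~Q i i≢r) j)
            (λ j → trans
              (sum-cong-≋ (λ k → trans (*-congʳ {N k j} (Mᵣ k))
                (trans (distribʳ _ _ _) (+-congʳ (*-assoc _ _ _)))))
              (sum-linear a (λ k → P r k * N k j) (λ k → Q r k * N k j)))
        }
      ; alternating = λ r≢s M Mᵣ≈Mₛ → det-alternating r≢s (M · N) (·-congʳ Mᵣ≈Mₛ)
      }
      where
      ·-congʳ : {u v : Vector Carrier n} → (∀ k → u k ≈ v k) →
                ∀ j → sum (λ k → u k * N k j) ≈ sum (λ k → v k * N k j)
      ·-congʳ u≈v j = sum-cong-≋ (λ k → *-congʳ {N k j} (u≈v k))

  -- The left side is alternating in `M`, and relabelling `δ` by an injection gives `δ` again.
  -- Separate sizes `m` and `n` allow for `N ℕ* F` and `F ℕ* N`, which are not equal by definition.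
  det-permute : (π : Permutation m n) (M : Matrix n n) →
                det (λ i j → M (π ⟨$⟩ʳ i) (π ⟨$⟩ʳ j)) ≈ det M
  det-permute {m} {n} π M = begin
    det (λ i j → M (π ⟨$⟩ʳ i) (π ⟨$⟩ʳ j))         ≈⟨ alternating-unique alt M ⟩
    det (λ i j → δ (π ⟨$⟩ʳ i) (π ⟨$⟩ʳ j)) * det M ≈⟨ *-congʳ (trans
      (det-cong (λ i j → reflexive (δ-injective (π ⟨$⟩ʳ_) injective i j))) (det-δ {m})) ⟩
    1# * det M                                    ≈⟨ *-identityˡ _ ⟩
    det M                                         ∎
    where
    injective : ∀ {i j} → π ⟨$⟩ʳ i ≡ π ⟨$⟩ʳ j → i ≡ j
    injective eq = ≡.trans (≡.sym (inverseˡ π)) (≡.trans (≡.cong (π ⟨$⟩ˡ_) eq) (inverseˡ π))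

    ⟨$⟩ʳ-≢ : ∀ {r i} → i ≢ π ⟨$⟩ˡ r → π ⟨$⟩ʳ i ≢ r
    ⟨$⟩ʳ-≢ i≢ eq = i≢ (≡.trans (≡.sym (inverseˡ π)) (≡.cong (π ⟨$⟩ˡ_) eq))

    P : Matrix n n → Matrix m m
    P M i j = M (π ⟨$⟩ʳ i) (π ⟨$⟩ʳ j)

    alt : IsAlternating (λ M → det (P M))
    alt = record
      { isMultilinear = record
        { cong   = λ {M} {N} M≋N → det-cong {M = P M} {P N} (λ i j → M≋N _ _)
        ; linear = λ r a {M} {M₁} {M₂} M~M₁ M~M₂ Mᵣ → det-linear (π ⟨$⟩ˡ r) a {P M} {P M₁} {P M₂}
            (λ i i≢ j → M~M₁ _ (⟨$⟩ʳ-≢ i≢) _)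
            (λ i i≢ j → M~M₂ _ (⟨$⟩ʳ-≢ i≢) _)
            -- Row `π ⟨$⟩ˡ r` of `P M` comes from row `π ⟨$⟩ʳ (π ⟨$⟩ˡ r)` of `M`, which is `r` only
            -- propositionally; hence the transport.
            (λ j → ≡.subst (λ s → M s (π ⟨$⟩ʳ j) ≈ a * M₁ s (π ⟨$⟩ʳ j) + M₂ s (π ⟨$⟩ʳ j))
              (≡.sym (inverseʳ π)) (Mᵣ (π ⟨$⟩ʳ j)))
        }
      ; alternating = λ {r} {s} r≢s M Mᵣ≈Mₛ → det-alternating {r = π ⟨$⟩ˡ r} {π ⟨$⟩ˡ s}
          (λ eq → r≢s (≡.trans (≡.sym (inverseʳ π)) (≡.trans (≡.cong (π ⟨$⟩ʳ_) eq) (inverseʳ π))))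
          (P M)
          (λ j → ≡.subst₂ (λ r s → M r (π ⟨$⟩ʳ j) ≈ M s (π ⟨$⟩ʳ j))
            (≡.sym (inverseʳ π)) (≡.sym (inverseʳ π)) (Mᵣ≈Mₛ (π ⟨$⟩ʳ j)))
      }

  -- Block matrices.

  -- Together with `punchIn-↑ʳ` this identifies the blocks that remain when a column of the left
  -- block is deleted.
  punchIn-↑ˡ : ∀ n (i : Fin (suc m)) (j : Fin m) → punchIn (i ↑ˡ n) (j ↑ˡ n) ≡ punchIn i j ↑ˡ n
  punchIn-↑ˡ n zero    j       = ≡.refl
  punchIn-↑ˡ n (suc i) zero    = ≡.refl
  punchIn-↑ˡ n (suc i) (suc j) = ≡.cong suc (punchIn-↑ˡ n i j)

  punchIn-↑ʳ : (i : Fin (suc m)) (j : Fin n) → punchIn (i ↑ˡ n) (m ↑ʳ j) ≡ suc m ↑ʳ j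
  punchIn-↑ʳ             zero    j = ≡.refl
  punchIn-↑ʳ {m = suc m} (suc i) j = ≡.cong suc (punchIn-↑ʳ i j)

  -- In the expansion along row 0 the right-hand columns contribute nothing. Every other minor is
  -- again block triangular, with the same lower right block, so induction on `m` applies.
  det-block-triangular : ∀ m (M : Matrix (m ℕ+ n) (m ℕ+ n)) →
    (∀ i j → M (i ↑ˡ n) (m ↑ʳ j) ≈ 0#) →
    det M ≈ det (λ i j → M (i ↑ˡ n) (j ↑ˡ n)) * det (λ i j → M (m ↑ʳ i) (m ↑ʳ j))
  det-block-triangular         zero    M M₁₂≈0 = sym (*-identityˡ _)
  det-block-triangular {n = n} (suc m) M M₁₂≈0 = begin
    det M
      ≈⟨ sum-splitAt (suc m) (λ j → sign j * M zero j * det (minor M j)) ⟩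
    sum (λ j → sign (j ↑ˡ n) * M zero (j ↑ˡ n) * det (minor M (j ↑ˡ n))) +
      sum (λ j → sign (suc m ↑ʳ j) * M zero (suc m ↑ʳ j) * det (minor M (suc m ↑ʳ j)))
      ≈⟨ +-cong (sum-cong-≋ left) (sum-zero right) ⟩
    sum (λ j → sign j * M₁₁ zero j * det (minor M₁₁ j) * det M₂₂) + 0#
      ≈⟨ +-identityʳ _ ⟩
    sum (λ j → sign j * M₁₁ zero j * det (minor M₁₁ j) * det M₂₂)
      ≈⟨ *-distribʳ-sum (det M₂₂) (λ j → sign j * M₁₁ zero j * det (minor M₁₁ j)) ⟨
    det M₁₁ * det M₂₂ ∎
    where
    M₁₁ : Matrix (suc m) (suc m)
    M₁₁ i j = M (i ↑ˡ n) (j ↑ˡ n)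

    M₂₂ : Matrix n n
    M₂₂ i j = M (suc m ↑ʳ i) (suc m ↑ʳ j)

    right : ∀ j → sign (suc m ↑ʳ j) * M zero (suc m ↑ʳ j) * det (minor M (suc m ↑ʳ j)) ≈ 0#
    right j = trans (*-congʳ (trans (*-congˡ (M₁₂≈0 zero j)) (zeroʳ (sign (suc m ↑ʳ j))))) (zeroˡ _)

    left : ∀ j → sign (j ↑ˡ n) * M zero (j ↑ˡ n) * det (minor M (j ↑ˡ n)) ≈
                 sign j * M₁₁ zero j * det (minor M₁₁ j) * det M₂₂
    left j = begin
      sign (j ↑ˡ n) * M zero (j ↑ˡ n) * det (minor M (j ↑ˡ n))
        ≈⟨ *-cong (*-congʳ (reflexive (≡.cong ((- 1#) ^_) (toℕ-↑ˡ j n))))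
                  (det-block-triangular m (minor M (j ↑ˡ n)) (λ i k →
                    trans (≡⇒≈M (punchIn-↑ʳ j k)) (M₁₂≈0 (suc i) k))) ⟩
      sign j * M₁₁ zero j *
        (det (λ i k → minor M (j ↑ˡ n) (i ↑ˡ n) (k ↑ˡ n)) * det (λ i k → minor M (j ↑ˡ n) (m ↑ʳ i) (m ↑ʳ k)))
        ≈⟨ *-congˡ (*-cong (det-cong (λ i k → ≡⇒≈M (punchIn-↑ˡ n j k)))
                           (det-cong (λ i k → ≡⇒≈M (punchIn-↑ʳ j k)))) ⟩
      sign j * M₁₁ zero j * (det (minor M₁₁ j) * det M₂₂)
        ≈⟨ *-assoc _ _ _ ⟨
      sign j * M₁₁ zero j * det (minor M₁₁ j) * det M₂₂ ∎
      where
      ≡⇒≈M : ∀ {i k l} → k ≡ l → M i k ≈ M i l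
      ≡⇒≈M {i} k≡l = reflexive (≡.cong (M i) k≡l)

  -- Indices are decoded exactly as in `_⊗_`, so entries can be computed on pairs (block, position)
  -- without index arithmetic.
  fromBlocks : (Fin m × Fin p → Fin n × Fin q → Carrier) → Matrix (m ℕ* p) (n ℕ* q)
  fromBlocks {m} {p} {n} {q} e r s = e (remQuot {m} p r) (remQuot {n} q s)

  fromBlocks-· : ∀ {m′ k n′} (e : Fin m × Fin m′ → Fin n × Fin n′ → Carrier)
                 (e′ : Fin n × Fin n′ → Fin p × Fin k → Carrier) →
                 fromBlocks e · fromBlocks e′ ≋
                 fromBlocks (λ x z → sum (λ i → sum (λ l → e x (i , l) * e′ (i , l) z)))
  fromBlocks-· {m} {n} {p} {m′} {k} {n′} e e′ r s = trans
    (sum-combine n (λ t → fromBlocks e r t * fromBlocks e′ t s))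
    (sum-cong-≋ (λ i → sum-cong-≋ (λ l → reflexive
      (≡.cong (λ y → e (remQuot {m} m′ r) y * e′ y (remQuot {p} k s)) (remQuot-combine i l)))))

  -- A constant family `const Z` gives the Kronecker product of the identity with `Z`.
  blockDiagonal : Vector (Matrix n n) m → Matrix (m ℕ* n) (m ℕ* n)
  blockDiagonal {n} {m} A = fromBlocks {m} {n} {m} {n} (λ (i , k) (j , l) → δ i j * A i k l)

  -- Since `suc m ℕ* n` unfolds to `n ℕ+ m ℕ* n`, the block `A zero` splits off by
  -- `det-block-triangular`.
  det-blockDiagonal : (A : Vector (Matrix n n) m) → det (blockDiagonal A) ≈ product (λ i → det (A i))
  det-blockDiagonal {m = zero}          A = refl
  det-blockDiagonal {n = n} {m = suc m} A = begin
    det (blockDiagonal A)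
      ≈⟨ det-block-triangular n (blockDiagonal A) (λ i j →
           trans (entry (remQuot-↑ˡ i) (remQuot-↑ʳ j)) (zeroˡ _)) ⟩
    det (λ i j → blockDiagonal A (i ↑ˡ (m ℕ* n)) (j ↑ˡ (m ℕ* n))) *
      det (λ i j → blockDiagonal A (n ↑ʳ i) (n ↑ʳ j))
      ≈⟨ *-cong
           (det-cong (λ i j → trans (entry (remQuot-↑ˡ i) (remQuot-↑ˡ j)) (*-identityˡ _)))
           (trans (det-cong (λ i j → entry (remQuot-↑ʳ i) (remQuot-↑ʳ j))) (det-blockDiagonal {m = m} (A ∘ suc))) ⟩
    det (A zero) * product (λ i → det (A (suc i))) ∎
    where
    e : Fin (suc m) × Fin n → Fin (suc m) × Fin n → Carrier
    e (i , k) (j , l) = δ i j * A i k l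

    entry : ∀ {r s x y} → remQuot {suc m} n r ≡ x → remQuot {suc m} n s ≡ y →
            blockDiagonal A r s ≈ e x y
    entry r≡x s≡y = reflexive (≡.cong₂ e r≡x s≡y)

    remQuot-↑ˡ : (k : Fin n) → remQuot {suc m} n (k ↑ˡ (m ℕ* n)) ≡ (zero , k)
    -- `k ↑ˡ (m ℕ* n)` is `combine zero k` by definition.
    remQuot-↑ˡ k = remQuot-combine {suc m} zero k

    remQuot-↑ʳ : (r : Fin (m ℕ* n)) → remQuot {suc m} n (n ↑ʳ r) ≡ map₁ suc (remQuot {m} n r)
    remQuot-↑ʳ r rewrite splitAt-↑ʳ n (m ℕ* n) r = ≡.refl

  -- Factorisation of the Kronecker sum and its determinant.

  det-sum-⊗-outer : ∀ {F N} (A : Vector (Matrix F F) N) (X Y : Matrix N N) →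
    det (sumᴹ (λ n → A n ⊗ (column X n · transpose (column Y n)))) ≈
    product (λ n → det (A n)) * det X ^ F * det Y ^ F
  det-sum-⊗-outer {F} {N} A X Y = begin
    det G
      ≈⟨ det-cong factorisation ⟩
    det (I⊗X · D · I⊗Yᵀ)
      ≈⟨ trans (det-· (I⊗X · D) I⊗Yᵀ) (*-congʳ (det-· I⊗X D)) ⟩
    det I⊗X * det D * det I⊗Yᵀ
      ≈⟨ *-cong (*-cong (det-scalar X) det-D) (trans (det-scalar (transpose Y)) (^-cong (det-transpose Y))) ⟩
    det X ^ F * product (λ n → det (A n)) * det Y ^ F
      ≈⟨ *-congʳ (*-comm _ _) ⟩
    product (λ n → det (A n)) * det X ^ F * det Y ^ F ∎
    where
    G I⊗X D I⊗Yᵀ : Matrix (F ℕ* N) (F ℕ* N)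
    G    = sumᴹ (λ n → A n ⊗ (column X n · transpose (column Y n)))
    I⊗X  = blockDiagonal {m = F} (const X)
    -- The sum over `n` in closed form: the unit matrix leaves only the term with `n` equal to both
    -- `k` and `l`.
    D    = fromBlocks (λ (i , k) (j , l) → A k i j * δ k l)
    I⊗Yᵀ = blockDiagonal {m = F} (const (transpose Y))

    -- A power is the product of a constant vector, so congruence is inherited from products.
    ^-cong : ∀ {x y} → x ≈ y → x ^ F ≈ y ^ F
    ^-cong x≈y = trans (sym (MonoidSum.sum-replicate *-monoid F))
      (trans (MonoidSum.sum-cong-≋ *-monoid {F} (λ _ → x≈y)) (MonoidSum.sum-replicate *-monoid F))

    det-scalar : (Z : Matrix N N) → det (blockDiagonal {m = F} (const Z)) ≈ det Z ^ F
    det-scalar Z = trans (det-blockDiagonal {m = F} (const Z)) (MonoidSum.sum-replicate *-monoid F)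

    -- The perfect shuffle: counting from 0, index `n * F + i` goes to `i * N + n`.
    interchange : Permutation (N ℕ* F) (F ℕ* N)
    interchange = ↔-sym *↔× ↔-∘ (×-comm (Fin N) (Fin F) ↔-∘ *↔×)

    det-D : det D ≈ product (λ n → det (A n))
    det-D = begin
      det D
        ≈⟨ det-permute interchange D ⟨
      det (λ r s → D (interchange ⟨$⟩ʳ r) (interchange ⟨$⟩ʳ s))
        ≈⟨ det-cong (λ r s → trans
             (reflexive (≡.cong₂ (λ (i , k) (j , l) → A k i j * δ k l)
               (remQuot-combine (proj₂ (remQuot {N} F r)) (proj₁ (remQuot {N} F r)))
               (remQuot-combine (proj₂ (remQuot {N} F s)) (proj₁ (remQuot {N} F s)))))
             (*-comm _ _)) ⟩
      det (blockDiagonal A)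
        ≈⟨ det-blockDiagonal A ⟩
      product (λ n → det (A n)) ∎

    -- The closed form of `I⊗X · D`: as `D` is diagonal in the second index, column `l` of `X` meets
    -- only `A l`.
    XD : Matrix (F ℕ* N) (F ℕ* N)
    XD = fromBlocks (λ (i , k) (j , l) → X k l * A l i j)

    I⊗X·D : I⊗X · D ≋ XD
    I⊗X·D r s = trans
      (fromBlocks-· {F} {F} {F} (λ (i , k) (j , l) → δ i j * X k l) (λ (i , k) (j , l) → A k i j * δ k l) r s)
      (entry (remQuot {F} N r) (remQuot {F} N s))
      where
      entry : ((i , k) (j , l) : Fin F × Fin N) →
              sum (λ i′ → sum (λ n → (δ i i′ * X k n) * (A n i′ j * δ n l))) ≈ X k l * A l i j
      entry (i , k) (j , l) = begin
        sum (λ i′ → sum (λ n → (δ i i′ * X k n) * (A n i′ j * δ n l)))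
          ≈⟨ sum-cong-≋ (λ i′ → trans
               (sum-cong-≋ (λ n → solve 4 (λ d x a e → (d :* x) :* (a :* e) := (d :* (x :* a)) :* e)
                 refl (δ i i′) (X k n) (A n i′ j) (δ n l)))
               (sum-δʳ l (λ n → δ i i′ * (X k n * A n i′ j)))) ⟩
        sum (λ i′ → δ i i′ * (X k l * A l i′ j))
          ≈⟨ sum-δˡ i (λ i′ → X k l * A l i′ j) ⟩
        X k l * A l i j ∎

    factorisation : G ≋ I⊗X · D · I⊗Yᵀ
    factorisation r s = sym (begin
      (I⊗X · D · I⊗Yᵀ) r s
        ≈⟨ sum-cong-≋ (λ t → *-congʳ {I⊗Yᵀ t s} (I⊗X·D r t)) ⟩
      (XD · I⊗Yᵀ) r s
        ≈⟨ fromBlocks-· {F} {F} {F} (λ (i , k) (j , l) → X k l * A l i j) (λ (i , k) (j , l) → δ i j * Y l k) r s ⟩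
      fromBlocks {F} {N} {F} {N} (λ (i , k) (j , l) →
          sum (λ j′ → sum (λ n → (X k n * A n i j′) * (δ j′ j * Y l n)))) r s
        ≈⟨ entry (remQuot {F} N r) (remQuot {F} N s) ⟩
      G r s ∎)
      where
      -- The product of a column and a row is a sum over `Fin 1`, which unfolds to a single term
      -- plus `0#`.
      entry : ((i , k) (j , l) : Fin F × Fin N) →
              sum (λ j′ → sum (λ n → (X k n * A n i j′) * (δ j′ j * Y l n))) ≈
              sum (λ n → A n i j * (X k n * Y l n + 0#))
      entry (i , k) (j , l) = begin
        sum (λ j′ → sum (λ n → (X k n * A n i j′) * (δ j′ j * Y l n)))
          ≈⟨ ∑-comm {F} {N} (λ j′ n → (X k n * A n i j′) * (δ j′ j * Y l n)) ⟩
        sum (λ n → sum (λ j′ → (X k n * A n i j′) * (δ j′ j * Y l n)))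
          ≈⟨ sum-cong-≋ (λ n → trans
               (sum-cong-≋ (λ j′ → solve 4 (λ x a d y → (x :* a) :* (d :* y) := (a :* (x :* y)) :* d)
                 refl (X k n) (A n i j′) (δ j′ j) (Y l n)))
               (sum-δʳ j (λ j′ → A n i j′ * (X k n * Y l n)))) ⟩
        sum (λ n → A n i j * (X k n * Y l n))
          ≈⟨ sum-cong-≋ (λ n → *-congˡ {A n i j} (+-identityʳ _)) ⟨
        sum (λ n → A n i j * (X k n * Y l n + 0#)) ∎

mainTheorem1 : ∀ {c ℓ₁ ℓ₂} (K : HeytingField c ℓ₁ ℓ₂) →
    let open HeytingField K
        open Matrices (HeytingCommutativeRing.commutativeRing heytingCommutativeRing) in
    (F N : ℕ) .{{_ : NonZero F}} .{{_ : NonZero N}} →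
    (A : Vector (Matrix F F) N) (X Y : Matrix N N) →
    let x = column X
        y = column Y
        B = λ n → x n · transpose (y n)
        G = sumᴹ (λ n → A n ⊗ B n) in
    det G ≈ product (λ n → det (A n)) * det X ^ F * det Y ^ F
mainTheorem1 K F N = Determinant.det-sum-⊗-outer commutativeRing
  where open HeytingCommutativeRing (HeytingField.heytingCommutativeRing K)
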